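{- For each nonnegative integer $k$, the restriction of $\mathrm{DL}_k$ to $\mathcal U_{2k+1}(231,312)$ is a bijection from $\mathcal U_{2k+1}(231,312)$ to $\mathrm{Int}(\mathcal A_k)=\{(\Lambda,\Lambda):\Lambda\in\mathbf D_k\}$. Hence $|\mathcal U_{2k+1}(231,312)|=C_k=\frac{1}{k+1}\binom{2k}{k}$.
   Context: Permutations are finite words of distinct positive integers; $S_n$ is the set of permutations of $[n]$. The stack-sorting map $s$: $s(\text{empty})=\text{empty}$, and if $\pi=LnR$ with $n$ the largest entry, $s(\pi)=s(L)s(R)n$. $\pi$ is uniquely sorted if it has exactly one preimage under $s$. A permutation avoids $\tau$ if no subsequence has the same relative order as $\tau$; $\mathcal U_n(\tau^{(1)},\dots)$ is the set of uniquely sorted permutations in $S_n$ avoiding the listed patterns. A descent of $\pi$ is an index $i$ with $\pi_i>\pi_{i+1}$; $\mathrm{Des}(\pi)$ is the set of descents. $\mathrm{rot}(\pi)=\mathrm{rev}(\pi^{ -1})$, where $\mathrm{rev}$ reverses the word and $\pi^{ -1}$ is the group inverse. $\mathbf D_k$ is the set of Dyck paths of semilength $k$ (words in $\{U,D\}$ with $k$ of each letter, every prefix having at least as many $U$'s as $D$'s); $\mathcal A_k$ is the antichain on $\mathbf D_k$, and $\mathrm{Int}(P)$ is the set of pairs $(x,y)$ with $x\le y$ in $P$. For $\pi\in\mathcal U_{2k+1}(312)$, $n=2k+1$, let $\Lambda_i=D$ if $n-i\in\mathrm{Des}(\pi)$ and $U$ otherwise, $\Lambda'_i=U$ if $i\in\mathrm{Des}(\mathrm{rot}(\pi))$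 and $D$ otherwise ($1\le i\le 2k$), and $\mathrm{DL}_k(\pi)=(\Lambda_1\cdots\Lambda_{2k},\Lambda'_1\cdots\Lambda'_{2k})$. -}

module Defs where

open import Data.Nat using (ℕ; zero; suc; _+_; _*_; _∸_; _≤_; _<_; _⊔_; _≡ᵇ_; _<ᵇ_; _≤ᵇ_)
open import Data.Bool using (Bool; true; false; if_then_else_; _∧_; not)
open import Data.List using (List; []; _∷_; _++_; length; map; upTo; foldr; takeWhileᵇ; drop; reverse; take; filterᵇ)
open import Data.List.Relation.Binary.Permutation.Propositional using (_↭_)
open import Data.List.Relation.Binary.Sublist.Propositional using (_⊆_)
open import Data.List.Relation.Unary.All using (All)
open import Data.Product using (Σ; _×_; _,_; ∃)
open import Relation.Binary.PropositionalEquality using (_≡_)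
open import Relation.Nullary using (¬_)
open import Function.Bundles using (_⇔_)

-- 0-indexed lookup with default 0 (only used at in-range indices)
at : List ℕ → ℕ → ℕ
at []       _       = 0
at (x ∷ xs) zero    = x
at (x ∷ xs) (suc i) = at xs i

oneTo : ℕ → List ℕ
oneTo n = map suc (upTo n)

IsPerm : ℕ → List ℕ → Set
IsPerm n w = w ↭ oneTo n

-- Stack-sorting map: s(LnR) = s(L) s(R) n, n the largest entry.
-- Defined with fuel; fuel = length w is always sufficient.

maxL : List ℕ → ℕ
maxL = foldr _⊔_ 0

sFuel : ℕ → List ℕ → List ℕ
sFuel zero    w  = []
sFuel (suc f) [] = []
sFuel (suc f) w@(_ ∷ _) =
  let m = maxL w
      L = takeWhileᵇ (λ x → not (x ≡ᵇ m)) w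
      R = drop (suc (length L)) w
  in sFuel f L ++ sFuel f R ++ (m ∷ [])

s : List ℕ → List ℕ
s w = sFuel (length w) w

UniquelySorted : ℕ → List ℕ → Set
UniquelySorted n π =
  Σ (List ℕ) λ σ → IsPerm n σ × s σ ≡ π × (∀ τ → IsPerm n τ → s τ ≡ π → τ ≡ σ)

SameOrder : List ℕ → List ℕ → Set
SameOrder σ τ = length σ ≡ length τ ×
  (∀ i j → i < length σ → j < length σ → (at σ i < at σ j) ⇔ (at τ i < at τ j))

Contains : List ℕ → List ℕ → Set
Contains π τ = Σ (List ℕ) λ σ → σ ⊆ π × SameOrder σ τ

Avoids : List ℕ → List ℕ → Set
Avoids π τ = ¬ Contains π τ

𝒰 : ℕ → List (List ℕ) → List ℕ → Set
𝒰 n pats π = IsPerm n π × UniquelySorted n π × All (Avoids π) pats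

-- Descents (1-based): i ∈ Des(π) iff 1 ≤ i < length π and π_i > π_{i+1}

isDes : List ℕ → ℕ → Bool
isDes π zero    = false
isDes π (suc i) = (suc i <ᵇ length π) ∧ (at π (suc i) <ᵇ at π i)

indexOf : ℕ → List ℕ → ℕ
indexOf j []       = 0
indexOf j (x ∷ xs) = if x ≡ᵇ j then 0 else suc (indexOf j xs)

inv : List ℕ → List ℕ
inv π = map (λ j → suc (indexOf j π)) (oneTo (length π))

rot : List ℕ → List ℕ
rot π = reverse (inv π)

data Step : Set where
  U D : Step

countU countD : List Step → ℕ
countU []      = 0
countU (U ∷ w) = suc (countU w)
countU (D ∷ w) = countU w
countD []      = 0
countD (U ∷ w) = countD w
countD (D ∷ w) = suc (countD w)

IsDyck : ℕ → List Step → Set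
IsDyck k w = countU w ≡ k × countD w ≡ k × (∀ i → countD (take i w) ≤ countU (take i w))

-- order of the antichain 𝒜_k on 𝐃_k
_≤𝒜_ : List Step → List Step → Set
x ≤𝒜 y = x ≡ y

Int𝒜 : ℕ → List Step × List Step → Set
Int𝒜 k (x , y) = IsDyck k x × IsDyck k y × x ≤𝒜 y

DL : ℕ → List ℕ → List Step × List Step
DL k π =
  let n = suc (2 * k)
      Λ  = λ i → if isDes π (n ∸ i) then D else U
      Λ' = λ i → if isDes (rot π) i then U else D
  in map Λ (oneTo (2 * k)) , map Λ' (oneTo (2 * k))

{-# OPTIONS --safe #-}

-- A permutation σ is the inorder word of a decreasing binary tree t, and s(σ) is the
-- postorder word of t, so the preimages of π are the decreasing trees with postorder
-- word π. If there is only one such tree, every inner node has two children (an only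
-- child could change sides) and π has a descent at the junction of the two subtrees
-- (otherwise the left one could move below the first leaf of the right one); the
-- word Λ of such a tree is U Λ(right) D Λ(left), a Dyck path. Conversely a tree has at
-- least as many ascents as descents in its postorder word, with equality only for
-- trees of this kind, and these are determined by π. Permutations avoiding 231 and
-- 312 are the layered ones; they are involutions determined by their descents, and
-- when Λ is a Dyck path the tree is built by a stack, an ascent joining two trees
-- below a new entry larger than everything before it.
--
-- We write ρ for the reverse of π, so that Λ and Λ' are read off ρ from left to right.
module Submission where

open import Defs
open import Data.Nat using (ℕ; zero; suc; _+_; _*_; _∸_; _/_; _≤_; _<_; _<ᵇ_; _≡ᵇ_; z≤n; s≤s; s≤s⁻¹)
open import Data.Nat.Properties
open import Data.Nat.Combinatorics using (_C_; nCk≡nC[n∸k]; nCk+nC[k+1]≡[n+1]C[k+1]; nC1≡n; k>n⇒nCk≡0)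
open import Data.Nat.DivMod using (m*n/n≡m; /-congˡ)
open import Data.Nat.Tactic.RingSolver using (solve-∀)
open import Data.Bool using (true; false; if_then_else_; not; T)
open import Data.Empty using (⊥; ⊥-elim)
open import Data.List using (List; []; _∷_; [_]; _++_; _∷ʳ_; length; map; reverse;
  take; drop; takeWhileᵇ; concatMap; applyUpTo; initLast; _∷ʳ′_)
open import Data.List.Properties
  using (++-assoc; ++-identityʳ; ∷-injective; ∷-injectiveʳ; ∷ʳ-injective; length-++; length-map; length-reverse;
         reverse-++; reverse-involutive; unfold-reverse; map-++; map-upTo; map-applyUpTo; map-cong-local)
open import Data.List.Membership.Propositional using (_∈_; _∉_)
open import Data.List.Membership.Propositional.Properties using (∈-++⁻; ∈-++⁺ˡ; ∈-++⁺ʳ; ∈-map⁺; ∈-map⁻)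
open import Data.List.Relation.Unary.All as All using (All; []; _∷_)
import Data.List.Relation.Unary.All.Properties as All
open import Data.List.Relation.Unary.AllPairs using (AllPairs; []; _∷_)
open import Data.List.Relation.Unary.Any using (here; there)
open import Data.List.Relation.Unary.Unique.Propositional using (Unique)
import Data.List.Relation.Unary.Unique.Propositional.Properties as Unique
open import Data.List.Relation.Binary.Permutation.Propositional
  using (_↭_; ↭-refl; ↭-sym; ↭-trans; ↭-reflexive; ↭-prep; ↭⇒↭ₛ)
open import Data.List.Relation.Binary.Permutation.Propositional.Properties as Perm
  using (All-resp-↭; ++-comm; shift; ↭-reverse; ∈-resp-↭; drop-∷; drop-mid; ↭-length)
import Data.List.Relation.Binary.Permutation.Setoid.Properties as PermSetoid
open import Data.List.Relation.Binary.Sublist.Propositional using (_⊆_; []; _∷_; from∈; to∈) renaming (_∷ʳ_ to skip)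
import Data.List.Relation.Binary.Sublist.Propositional.Properties as Sublist
open import Data.Vec using (Vec; []; _∷_; toList)
open import Data.Vec.Relation.Unary.All as VecAll using ([]; _∷_)
open import Data.Product using (Σ; ∃; ∃₂; _×_; _,_; proj₁; proj₂)
open import Data.Sum using (_⊎_; inj₁; inj₂)
open import Function.Base using (_∘_)
open import Function.Bundles using (_⇔_; mk⇔; Equivalence)
open import Relation.Nullary using (¬_)
open import Relation.Binary.Definitions using (tri<; tri≈; tri>)
open import Relation.Binary.PropositionalEquality hiding ([_])

-- Step words of reversed permutations

step : ℕ → ℕ → Step
step x y = if y <ᵇ x then U else D

-- A drop of `ρ` is an ascent of π, hence the letter `U` as in Λ. When π is an involution, `rot π`
-- is `ρ`, so the same drop is a descent of `rot π` and gives `U` in Λ' as well.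
profile : List ℕ → List Step
profile []           = []
profile (x ∷ [])     = []
profile (x ∷ y ∷ zs) = step x y ∷ profile (y ∷ zs)

<ᵇ-true : ∀ {m n} → m < n → (m <ᵇ n) ≡ true
<ᵇ-true {m} {n} m<n with m <ᵇ n in eq
... | true  = refl
... | false = ⊥-elim (subst T eq (<⇒<ᵇ m<n))

<ᵇ-false : ∀ {m n} → n ≤ m → (m <ᵇ n) ≡ false
<ᵇ-false {m} {n} n≤m with m <ᵇ n in eq
... | true  = ⊥-elim (<⇒≱ (<ᵇ⇒< m n (subst T (sym eq) _)) n≤m)
... | false = refl

step-U : ∀ {x y} → y < x → step x y ≡ U
step-U y<x rewrite <ᵇ-true y<x = refl

step-D : ∀ {x y} → x ≤ y → step x y ≡ D
step-D x≤y rewrite <ᵇ-false x≤y = refl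

profile-++ : ∀ xs a y zs →
  profile ((xs ∷ʳ a) ++ y ∷ zs) ≡ profile (xs ∷ʳ a) ++ step a y ∷ profile (y ∷ zs)
profile-++ []            a y zs = refl
profile-++ (x ∷ [])      a y zs = refl
profile-++ (x ∷ x′ ∷ xs) a y zs = cong (step x x′ ∷_) (profile-++ (x′ ∷ xs) a y zs)

length-profile : ∀ x xs → length (profile (x ∷ xs)) ≡ length xs
length-profile x []       = refl
length-profile x (y ∷ xs) = cong suc (length-profile y xs)

-- Decreasing binary trees

data Tree : Set where
  nil  : Tree
  node : Tree → ℕ → Tree → Tree

-- In `rpost` a root precedes its right subtree and then its left one, so that a tree can be parsed
-- from left to right.
inorder postorder rpost : Tree → List ℕ
inorder nil            = []
inorder (node l m r)   = inorder l ++ m ∷ inorder r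
postorder nil          = []
postorder (node l m r) = postorder l ++ postorder r ++ [ m ]
rpost nil              = []
rpost (node l m r)     = m ∷ rpost r ++ rpost l

data Heap : Tree → Set where
  nil  : Heap nil
  node : ∀ {l m r} → Heap l → All (_< m) (rpost l) → Heap r → All (_< m) (rpost r) → Heap (node l m r)

-- Every inner node has two children, and at the junction of its two subtrees
-- the postorder word has a descent.
data Good : Tree → Set where
  leaf : ∀ {m} → Good (node nil m nil)
  fork : ∀ {l m r xs a y ys} → Good l → Good r →
         rpost r ≡ xs ∷ʳ a → rpost l ≡ y ∷ ys → a ≤ y → Good (node l m r)

-- The right subtree is nonempty, so the root is followed by a smaller entry, which gives the
-- leading `U`. The letter `step a y` belongs to the junction of the two subtrees.
profile-rpost : ∀ {l m r xs a y ys} → Heap (node l m r) →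
  rpost r ≡ xs ∷ʳ a → rpost l ≡ y ∷ ys →
  profile (rpost (node l m r)) ≡ U ∷ profile (rpost r) ++ step a y ∷ profile (rpost l)
profile-rpost {xs = []}     {a} {y} {ys} (node _ _ _ r<m) er el rewrite er | el =
  cong (_∷ _) (step-U (All.head r<m))
profile-rpost {xs = x ∷ xs} {a} {y} {ys} (node _ _ _ r<m) er el rewrite er | el =
  cong₂ _∷_ (step-U (All.head r<m)) (profile-++ (x ∷ xs) a y ys)

-- Good trees and balanced words

data Walk : ℕ → List Step → Set where
  []  : Walk 0 []
  U∷_ : ∀ {h w} → Walk (suc h) w → Walk h (U ∷ w)
  D∷_ : ∀ {h w} → Walk h w → Walk (suc h) (D ∷ w)

-- The continuation `w` makes the induction compose: the root goes up by one, the right subtree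
-- returns to that height, the junction goes down by one, and the left subtree returns to `h`.
good-walk : ∀ {t h w} → Heap t → Good t → Walk h w → Walk h (profile (rpost t) ++ w)
good-walk H leaf w = w
good-walk {node l m r} {w = w} H@(node Hl _ Hr _) (fork {a = a} {y} gl gr er el a≤y) p
  rewrite profile-rpost H er el | step-D a≤y
        | ++-assoc (profile (rpost r)) (D ∷ profile (rpost l)) w
  = U∷ good-walk Hr gr (D∷ good-walk Hl gl p)

walk-count : ∀ {h w} → Walk h w → h + countU w ≡ countD w
walk-count []     = refl
walk-count {h} (U∷ p) = trans (+-suc h _) (walk-count p)
walk-count (D∷ p) = cong suc (walk-count p)

countU-++ : ∀ v w → countU (v ++ w) ≡ countU v + countU w
countU-++ []      w = refl
countU-++ (U ∷ v) w = cong suc (countU-++ v w)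
countU-++ (D ∷ v) w = countU-++ v w

countD-++ : ∀ v w → countD (v ++ w) ≡ countD v + countD w
countD-++ []      w = refl
countD-++ (U ∷ v) w = countD-++ v w
countD-++ (D ∷ v) w = cong suc (countD-++ v w)

Balanced : List Step → Set
Balanced w = countU w ≡ countD w

snoc-view : ∀ (x : ℕ) xs → ∃₂ λ ys a → x ∷ xs ≡ ys ∷ʳ a
snoc-view x xs with initLast xs
... | []      = [] , x , refl
... | ys ∷ʳ′ a = x ∷ ys , a , refl

module _ where
  private
    cU cD : List ℕ → ℕ
    cU ρ = countU (profile ρ)
    cD ρ = countD (profile ρ)

    under : ∀ {m y ys} → y < m → cD (y ∷ ys) ≤ cU (y ∷ ys) → cD (m ∷ y ∷ ys) < cU (m ∷ y ∷ ys)
    under y<m le rewrite step-U y<m = s≤s le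

    +-tight : ∀ {a b c d} → a ≤ c → b ≤ d → a + b ≡ c + d → a ≡ c × b ≡ d
    +-tight {a} {b} {c} {d} a≤c b≤d eq with m≤n⇒m<n∨m≡n a≤c
    ... | inj₁ a<c  = ⊥-elim (<⇒≢ (+-mono-<-≤ a<c b≤d) eq)
    ... | inj₂ refl = refl , +-cancelˡ-≡ a b d eq

  -- A descent needs a node with two children, while each node that is not a leaf
  -- gives an ascent.
  tight : ∀ {t} → Heap t → countD (profile (rpost t)) ≤ countU (profile (rpost t))
        × (t ≢ nil → Balanced (profile (rpost t)) → Good t)
  tight nil = z≤n , λ t≢ → ⊥-elim (t≢ refl)
  tight (node {nil} {r = nil} _ _ _ _) = z≤n , λ _ _ → leaf
  tight (node {nil} {m} {node r₁ y r₂} _ _ Hr r<m) rewrite ++-identityʳ (rpost r₂ ++ rpost r₁) =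
    let lt = under {m} {y} {rpost r₂ ++ rpost r₁} (All.head r<m) (proj₁ (tight Hr))
    in <⇒≤ lt , λ _ eq → ⊥-elim (<⇒≢ lt (sym eq))
  tight (node {node l₁ y l₂} {m} {nil} Hl l<m _ _) =
    let lt = under {m} {y} {rpost l₂ ++ rpost l₁} (All.head l<m) (proj₁ (tight Hl))
    in <⇒≤ lt , λ _ eq → ⊥-elim (<⇒≢ lt (sym eq))
  tight H@(node {l@(node l₁ y l₂)} {m} {r@(node r₁ x r₂)} Hl l<m Hr r<m)
    with snoc-view x (rpost r₂ ++ rpost r₁)
  ... | xs , a , er with <-≤-connex y a
  ...   | inj₁ y<a = <⇒≤ lt , λ _ eq → ⊥-elim (<⇒≢ lt (sym eq))
    where
    P = profile (rpost r)
    Q = profile (rpost l)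
    lt : cD (rpost (node l m r)) < cU (rpost (node l m r))
    lt rewrite profile-rpost H er refl | step-U y<a | countU-++ P (U ∷ Q) | countD-++ P (U ∷ Q)
             | +-suc (countU P) (countU Q) =
      s≤s (≤-trans (+-mono-≤ (proj₁ (tight Hr)) (proj₁ (tight Hl))) (n≤1+n _))
  -- The `D` at the junction offsets the `U` of the root, so balance of the whole word forces
  -- equality in the bounds for both subtrees.
  ...   | inj₂ a≤y = le , λ _ eq →
    let er≡ , el≡ = +-tight (proj₁ (tight Hr)) (proj₁ (tight Hl))
                      (suc-injective (trans (sym (proj₁ counts)) (trans (sym eq) (proj₂ counts))))
    in fork (proj₂ (tight Hl) (λ ()) (sym el≡)) (proj₂ (tight Hr) (λ ()) (sym er≡)) er refl a≤y
    where
    P = profile (rpost r)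
    Q = profile (rpost l)
    counts : cD (rpost (node l m r)) ≡ suc (countD P + countD Q)
           × cU (rpost (node l m r)) ≡ suc (countU P + countU Q)
    counts rewrite profile-rpost H er refl | step-D a≤y | countU-++ P (D ∷ Q) | countD-++ P (D ∷ Q)
             | +-suc (countD P) (countD Q) = refl , refl
    le : cD (rpost (node l m r)) ≤ cU (rpost (node l m r))
    le rewrite proj₁ counts | proj₂ counts = s≤s (+-mono-≤ (proj₁ (tight Hr)) (proj₁ (tight Hl)))

-- Uniqueness of the tree with a given word

Boundary : Tree → List ℕ → Set
Boundary t X = ∀ {xs a y ys} → rpost t ≡ xs ∷ʳ a → X ≡ y ∷ ys → a ≤ y

-- Prefix-code decoding: an entry is an inner node iff the next entry is smaller.
good-parse : ∀ {t t′ X X′} → Heap t → Heap t′ → Good t → Good t′ →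
  Boundary t X → Boundary t′ X′ → rpost t ++ X ≡ rpost t′ ++ X′ → t ≡ t′ × X ≡ X′
good-parse H H′ leaf leaf b b′ refl = refl , refl
-- The leaf would be followed by the root of the other tree's right subtree, which is smaller by the
-- heap order; `Boundary` excludes this.
good-parse H (node _ _ _ r<m) leaf (fork {r = node _ y r₂} gl gr er el a≤y) b b′ refl =
  ⊥-elim (<⇒≱ (All.head r<m) (b {[]} refl refl))
good-parse (node _ _ _ r<m) H′ (fork {r = node _ y r₂} gl gr er el a≤y) leaf b b′ refl =
  ⊥-elim (<⇒≱ (All.head r<m) (b′ {[]} refl refl))
good-parse {node l m r} {node l′ m′ r′} {X} {X′} (node Hl _ Hr _) (node Hl′ _ Hr′ _)
  (fork {xs = xs} {a} {y} {ys} gl gr er el a≤y) (fork {xs = xs′} {a′} {y′} {ys′} gl′ gr′ er′ el′ a≤y′) b b′ eq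
  with ∷-injective eq
... | refl , eq₁ with good-parse Hr Hr′ gr gr′ (bound er el a≤y) (bound er′ el′ a≤y′)
       (trans (sym (++-assoc (rpost r) _ X)) (trans eq₁ (++-assoc (rpost r′) _ X′)))
  where
  bound : ∀ {l r xs a y ys X} → rpost r ≡ xs ∷ʳ a → rpost l ≡ y ∷ ys → a ≤ y → Boundary r (rpost l ++ X)
  bound {xs = xs} er el a≤y {xs″} er″ el″ rewrite el with ∷-injective el″ | ∷ʳ-injective xs xs″ (trans (sym er) er″)
  ... | refl , _ | _ , refl = a≤y
... | refl , eq₂ with good-parse Hl Hl′ gl gl′ (last-bound b) (last-bound b′) eq₂
  where
  -- The left subtree comes last in `rpost`, so it shares its last entry, and whatever follows, with
  -- the whole node.
  last-bound : ∀ {l m r X} → Boundary (node l m r) X → Boundary l X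
  last-bound {m = m} {r} b {xs} {a} e f =
    b {m ∷ rpost r ++ xs} (cong (m ∷_) (trans (cong (rpost r ++_) e) (sym (++-assoc (rpost r) xs _)))) f
... | refl , eq₃ = refl , eq₃

good-injective : ∀ {t t′} → Heap t → Heap t′ → Good t → Good t′ → rpost t ≡ rpost t′ → t ≡ t′
good-injective H H′ g g′ eq =
  proj₁ (good-parse {X = []} {[]} H H′ g g′ (λ _ ()) (λ _ ()) (cong (_++ []) eq))

-- The last entry of `rpost r` is the leaf at the end of the left spine. Hanging `l` to the left of
-- this leaf appends `rpost l` to the word, and the bounds along the spine survive because each of
-- its entries exceeds `a`.
graft : ∀ {r} → Heap r → Good r → ∃₂ λ xs a → rpost r ≡ xs ∷ʳ a ×
  (∀ {l} → Heap l → All (_< a) (rpost l) → ∃ λ t → Heap t × rpost t ≡ rpost r ++ rpost l)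
graft {node nil m nil} _ leaf = [] , m , refl , λ {l} Hl l<m → node l m nil , node Hl l<m nil [] , refl
graft {node l m r} (node Hl l<m Hr r<m) (fork gl _ _ _ _) with graft Hl gl
... | xs , a , el , g = m ∷ rpost r ++ xs , a
  , cong (m ∷_) (trans (cong (rpost r ++_) el) (sym (++-assoc (rpost r) xs _))) , extend
  where
  a<m : a < m
  a<m = All.head (All.++⁻ʳ xs (subst (All (_< m)) el l<m))
  extend : ∀ {l′} → Heap l′ → All (_< a) (rpost l′) →
    ∃ λ t → Heap t × rpost t ≡ rpost (node l m r) ++ rpost l′
  extend {l′} Hl′ l′<a with g Hl′ l′<a
  ... | t , Ht , et = node t m r
                    , node Ht (subst (All (_< m)) (sym et) (All.++⁺ l<m (All.map (λ x<a → <-trans x<a a<m) l′<a))) Hr r<m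
                    , cong (m ∷_) (trans (cong (rpost r ++_) et) (sym (++-assoc (rpost r) (rpost l) _)))

-- The form that uniqueness of the preimage takes for trees: the heaps with a given postorder word
-- stand for the preimages of that word.
OnlyHeap : Tree → Set
OnlyHeap t = ∀ {t′} → Heap t′ → rpost t′ ≡ rpost t → t′ ≡ t

-- A second heap with the word of the subtree could be substituted into the whole tree without
-- changing its word.
only-left : ∀ {l m r} → Heap (node l m r) → OnlyHeap (node l m r) → OnlyHeap l
only-left {m = m} {r} (node _ l<m Hr r<m) only H eq
  with only (node H (subst (All (_< m)) (sym eq) l<m) Hr r<m) (cong (λ z → m ∷ rpost r ++ z) eq)
... | refl = refl

only-right : ∀ {l m r} → Heap (node l m r) → OnlyHeap (node l m r) → OnlyHeap r
only-right {l} {m} (node Hl l<m _ r<m) only H eq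
  with only (node Hl l<m H (subst (All (_< m)) (sym eq) r<m)) (cong (λ z → m ∷ z ++ rpost l) eq)
... | refl = refl

-- An ascent at the junction would let the left subtree move below the first leaf of
-- the right one.
only-fork : ∀ {l m r} → Heap (node l m r) → OnlyHeap (node l m r) → Good l → Good r → l ≢ nil →
  Good (node l m r)
only-fork {nil} _ _ _ _ l≢ = ⊥-elim (l≢ refl)
only-fork {node l₁ y l₂} {m} {r} (node Hl@(node _ l₁<y _ l₂<y) l<m Hr r<m) only gl gr _ with graft Hr gr
... | xs , a , er , g with <-≤-connex y a
...   | inj₂ a≤y = fork gl gr er refl a≤y
...   | inj₁ y<a with g Hl (y<a ∷ All.++⁺ (All.map (λ p → <-trans p y<a) l₂<y) (All.map (λ p → <-trans p y<a) l₁<y))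
...     | t , Ht , et with only {node nil m t} (node nil [] Ht (subst (All (_< m)) (sym et) (All.++⁺ r<m l<m)))
                              (cong (m ∷_) (trans (++-identityʳ _) et))
...       | ()

only-good : ∀ {t} → Heap t → OnlyHeap t → t ≢ nil → Good t
only-good nil _ t≢ = ⊥-elim (t≢ refl)
only-good (node {nil} {r = nil} _ _ _ _) only _ = leaf
-- An only child can change sides.
only-good (node {nil} {m} {r@(node _ _ _)} _ _ Hr r<m) only _
  with only {node r m nil} (node Hr r<m nil []) (cong (m ∷_) (sym (++-identityʳ _)))
... | ()
only-good (node {l@(node _ _ _)} {m} {nil} Hl l<m _ _) only _
  with only {node nil m l} (node nil [] Hl l<m) (cong (m ∷_) (++-identityʳ _))
... | ()
only-good H@(node {node _ _ _} {r = node _ _ _} Hl _ Hr _) only _ =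
  only-fork H only (only-good Hl (only-left H only) (λ ())) (only-good Hr (only-right H only) (λ ())) (λ ())

rpost-postorder : ∀ t → reverse (rpost t) ≡ postorder t
rpost-postorder nil = refl
rpost-postorder (node l m r) = begin
  reverse (m ∷ rpost r ++ rpost l)                ≡⟨ unfold-reverse m (rpost r ++ rpost l) ⟩
  reverse (rpost r ++ rpost l) ∷ʳ m               ≡⟨ cong (_∷ʳ m) (reverse-++ (rpost r) (rpost l)) ⟩
  (reverse (rpost l) ++ reverse (rpost r)) ∷ʳ m   ≡⟨ cong₂ (λ u v → (u ++ v) ∷ʳ m) (rpost-postorder l) (rpost-postorder r) ⟩
  (postorder l ++ postorder r) ∷ʳ m               ≡⟨ ++-assoc (postorder l) (postorder r) [ m ] ⟩
  postorder l ++ postorder r ∷ʳ m                 ∎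
  where open ≡-Reasoning

inorder↭rpost : ∀ t → inorder t ↭ rpost t
inorder↭rpost nil = ↭-refl
inorder↭rpost (node l m r) = ↭-trans (shift m (inorder l) (inorder r))
  (↭-prep m (↭-trans (++-comm (inorder l) (inorder r)) (Perm.++⁺ (inorder↭rpost r) (inorder↭rpost l))))

inorder-< : ∀ {t m} → All (_< m) (rpost t) → All (_< m) (inorder t)
inorder-< {t} = All-resp-↭ (↭-sym (inorder↭rpost t))

rpost-< : ∀ {t m} → All (_< m) (inorder t) → All (_< m) (rpost t)
rpost-< {t} = All-resp-↭ (inorder↭rpost t)

-- Trees and the stack-sorting map

maxL-≤ : ∀ {m xs} → All (_< m) xs → maxL xs ≤ m
maxL-≤ []       = z≤n
maxL-≤ (x<m ∷ p) = ⊔-lub (<⇒≤ x<m) (maxL-≤ p)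

maxL-split : ∀ {m L R} → All (_< m) L → All (_< m) R → maxL (L ++ m ∷ R) ≡ m
maxL-split []        r = m≥n⇒m⊔n≡m (maxL-≤ r)
maxL-split (x<m ∷ l) r rewrite maxL-split l r = m≤n⇒m⊔n≡n (<⇒≤ x<m)

≡ᵇ-refl : ∀ m → (m ≡ᵇ m) ≡ true
≡ᵇ-refl zero    = refl
≡ᵇ-refl (suc m) = ≡ᵇ-refl m

≢⇒≡ᵇ-false : ∀ {m n} → m ≢ n → (m ≡ᵇ n) ≡ false
≢⇒≡ᵇ-false {m} {n} m≢n with m ≡ᵇ n in eq
... | true  = ⊥-elim (m≢n (≡ᵇ⇒≡ m n (subst T (sym eq) _)))
... | false = refl

takeWhile-split : ∀ {m L R} → All (_< m) L → takeWhileᵇ (λ x → not (x ≡ᵇ m)) (L ++ m ∷ R) ≡ L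
takeWhile-split {m} [] rewrite ≡ᵇ-refl m = refl
takeWhile-split {m} {x ∷ L} (x<m ∷ l) rewrite ≢⇒≡ᵇ-false (<⇒≢ x<m) = cong (x ∷_) (takeWhile-split l)

drop-split : ∀ (L : List ℕ) {m R} → drop (suc (length L)) (L ++ m ∷ R) ≡ R
drop-split []      = refl
drop-split (x ∷ L) = drop-split L

-- One unfolding of `sFuel` with the maximum as a parameter, so that it can be rewritten before the
-- two parts are computed.
sSplit : ℕ → List ℕ → ℕ → List ℕ
sSplit f w m = let K = takeWhileᵇ (λ x → not (x ≡ᵇ m)) w
               in sFuel f K ++ sFuel f (drop (suc (length K)) w) ++ [ m ]

sFuel-max : ∀ f L {m R} → sFuel (suc f) (L ++ m ∷ R) ≡ sSplit f (L ++ m ∷ R) (maxL (L ++ m ∷ R))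
sFuel-max f []      = refl
sFuel-max f (_ ∷ _) = refl

sFuel-split : ∀ f {m L R} → All (_< m) L → All (_< m) R →
  sFuel (suc f) (L ++ m ∷ R) ≡ sFuel f L ++ sFuel f R ++ [ m ]
sFuel-split f {m} {L} {R} l r
  rewrite sFuel-max f L {m} {R} | maxL-split l r | takeWhile-split {m} {L} {R} l | drop-split L {m} {R} = refl

-- Stated for every sufficient amount of fuel, since both recursive calls receive the same `f` while
-- their words may be shorter.
sFuel-inorder : ∀ f {t} → Heap t → length (inorder t) ≤ f → sFuel f (inorder t) ≡ postorder t
sFuel-inorder zero    nil le = refl
sFuel-inorder (suc f) nil le = refl
sFuel-inorder zero (node {l} {m} {r} _ _ _ _) le =
  ⊥-elim (n≮0 (≤-trans (≤-trans (s≤s z≤n) (m≤n+m _ (length (inorder l)))) (subst (_≤ 0) (length-++ (inorder l)) le)))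
sFuel-inorder (suc f) (node {l} {m} {r} Hl l<m Hr r<m) le =
  trans (sFuel-split f (inorder-< l<m) (inorder-< r<m))
        (cong₂ (λ u v → u ++ v ++ [ m ]) (sFuel-inorder f Hl (m+n≤o⇒m≤o _ le′))
                                          (sFuel-inorder f Hr (m+n≤o⇒n≤o (length (inorder l)) le′)))
  where
  le′ : length (inorder l) + length (inorder r) ≤ f
  le′ = s≤s⁻¹ (subst (_≤ suc f) (trans (length-++ (inorder l)) (+-suc _ _)) le)

s-inorder : ∀ {t} → Heap t → s (inorder t) ≡ postorder t
s-inorder H = sFuel-inorder _ H ≤-refl

max-split : ∀ x xs → Unique (x ∷ xs) →
  ∃ λ L → ∃₂ λ m R → x ∷ xs ≡ L ++ m ∷ R × All (_< m) L × All (_< m) R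
max-split x [] _ = [] , x , [] , refl , [] , []
max-split x (y ∷ ys) ((x≢ ∷ x≢s) ∷ u) with max-split y ys u
... | L , m , R , eq , l , r with <-cmp x m
... | tri< x<m _ _ = x ∷ L , m , R , cong (x ∷_) eq , x<m ∷ l , r
... | tri> _ _ m<x = [] , x , y ∷ ys , refl , [] ,
      subst (All (_< x)) (sym eq) (All.++⁺ (All.map (λ p → <-trans p m<x) l) (m<x ∷ All.map (λ p → <-trans p m<x) r))
... | tri≈ _ x≡m _ = ⊥-elim (All.head (All.++⁻ʳ L (subst (All (x ≢_)) eq (x≢ ∷ x≢s))) x≡m)

-- The tree has the maximum at its root and is built recursively from the entries on either side;
-- `go` recurses on a bound for the length.
heap-of : ∀ σ → Unique σ → ∃ λ t → Heap t × inorder t ≡ σ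
heap-of σ = go (length σ) σ ≤-refl
  where
  unique-++ˡ : ∀ (xs : List ℕ) {ys} → Unique (xs ++ ys) → Unique xs
  unique-++ˡ []       _        = []
  unique-++ˡ (x ∷ xs) (p ∷ u) = All.++⁻ˡ xs p ∷ unique-++ˡ xs u
  unique-++ʳ : ∀ (xs : List ℕ) {ys} → Unique (xs ++ ys) → Unique ys
  unique-++ʳ []       u       = u
  unique-++ʳ (x ∷ xs) (p ∷ u) = unique-++ʳ xs u
  go : ∀ n σ → length σ ≤ n → Unique σ → ∃ λ t → Heap t × inorder t ≡ σ
  go _ [] _ _ = nil , nil , refl
  go (suc n) (x ∷ xs) le u with max-split x xs u
  ... | L , m , R , eq , l , r
    with go n L (m+n≤o⇒m≤o _ le′) (unique-++ˡ L u′)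
       | go n R (m+n≤o⇒n≤o (length L) le′) (drop-head (unique-++ʳ L u′))
    where
    u′ : Unique (L ++ m ∷ R)
    u′ = subst Unique eq u
    le′ : length L + length R ≤ n
    le′ = s≤s⁻¹ (subst (_≤ suc n) (trans (cong length eq) (trans (length-++ L) (+-suc _ _))) le)
    drop-head : ∀ {y : ℕ} {ys} → Unique (y ∷ ys) → Unique ys
    drop-head (_ ∷ u) = u
  ... | tl , Hl , refl | tr , Hr , refl = node tl m tr , node Hl (rpost-< l) Hr (rpost-< r) , sym eq

-- If the two cuts fell at different places, each of `m` and `m′` would lie in a part bounded by the
-- other.
split-injective : ∀ {m m′} L L′ {R R′} → All (_< m) L → All (_< m) R → All (_< m′) L′ → All (_< m′) R′ →
  L ++ m ∷ R ≡ L′ ++ m′ ∷ R′ → L ≡ L′ × m ≡ m′ × R ≡ R′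
split-injective [] [] _ _ _ _ refl = refl , refl , refl
split-injective [] (x ∷ L′) _ r (x<m′ ∷ _) _ refl = ⊥-elim (<-asym x<m′ (All.head (All.++⁻ʳ L′ r)))
split-injective (x ∷ L) [] (x<m ∷ _) _ _ r refl = ⊥-elim (<-asym x<m (All.head (All.++⁻ʳ L r)))
split-injective (x ∷ L) (x′ ∷ L′) (_ ∷ l) r (_ ∷ l′) r′ eq with ∷-injective eq
... | refl , eq′ with split-injective L L′ l r l′ r′ eq′
... | refl , refl , refl = refl , refl , refl

inorder-injective : ∀ {t t′} → Heap t → Heap t′ → inorder t ≡ inorder t′ → t ≡ t′
inorder-injective nil nil _ = refl
inorder-injective nil (node {l} _ _ _ _) eq with inorder l | eq
... | []    | ()
... | _ ∷ _ | ()
inorder-injective (node {l} _ _ _ _) nil eq with inorder l | eq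
... | []    | ()
... | _ ∷ _ | ()
inorder-injective (node {l} {m} Hl l<m Hr r<m) (node {l′} Hl′ l′<m Hr′ r′<m) eq
  with split-injective (inorder l) (inorder l′) (inorder-< l<m) (inorder-< r<m) (inorder-< l′<m) (inorder-< r′<m) eq
... | el , refl , er = cong₂ (λ u v → node u m v) (inorder-injective Hl Hl′ el) (inorder-injective Hr Hr′ er)

-- Existence of a tree for a 213-avoiding word

Avoids213 : List ℕ → Set
Avoids213 ρ = ∀ {x y z} → (x ∷ y ∷ z ∷ []) ⊆ ρ → y < x → x < z → ⊥

-- Reading from the right (that is, a permutation from left to right), a descent adds
-- a leaf to the forest and an ascent joins its last two trees.
forest : ∀ {h} x xs → Unique (x ∷ xs) → Avoids213 (x ∷ xs) → Walk h (profile (x ∷ xs)) →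
  Σ (Vec Tree (suc h)) λ ts → VecAll.All Heap ts × concatMap rpost (toList ts) ≡ x ∷ xs
forest x [] u av [] = node nil x nil ∷ [] , node nil [] nil [] ∷ [] , refl
forest x (y ∷ ys) (x≢ ∷ u) av w with <-≤-connex y x
... | inj₂ x≤y rewrite step-D x≤y with w
...   | D∷ w′ with forest y ys u (λ σ → av (skip x σ)) w′
...     | ts , Hs , eq = node nil x nil ∷ ts , node nil [] nil [] ∷ Hs , cong (x ∷_) eq
forest x (y ∷ ys) (x≢ ∷ u) av w | inj₁ y<x rewrite step-U y<x with w
...   | U∷ w′ with forest y ys u (λ σ → av (skip x σ)) w′
-- The rest of the walk starts at height `suc h`, so the forest has at least two trees to join.
...     | r ∷ l ∷ ts , Hr ∷ Hl ∷ Hs , eq =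
          node l x r ∷ ts
          , node Hl (All.++⁻ˡ (rpost l) (All.++⁻ʳ (rpost r) below)) Hr (All.++⁻ˡ (rpost r) below) ∷ Hs
          , cong (x ∷_) (trans (++-assoc (rpost r) (rpost l) _) eq)
  where
  -- A later entry above `x` would complete a 213 with `x` and `y`; hence `x` may serve as a root
  -- over everything after it.
  tail-below : All (_< x) ys
  tail-below = All.tabulate λ z∈ → ≤∧≢⇒< (≮⇒≥ (av (refl ∷ refl ∷ from∈ z∈) y<x)) (λ e → All.lookup x≢ (there z∈) (sym e))
  below : All (_< x) (rpost r ++ rpost l ++ concatMap rpost (toList ts))
  below = subst (All (_< x)) (sym eq) (y<x ∷ tail-below)

heap-exists : ∀ {ρ} → ρ ≢ [] → Unique ρ → Avoids213 ρ → Walk 0 (profile ρ) → ∃ λ t → Heap t × rpost t ≡ ρ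
heap-exists {[]} ρ≢ _ _ _ = ⊥-elim (ρ≢ refl)
heap-exists {x ∷ xs} _ u av w with forest x xs u av w
... | t ∷ [] , H ∷ [] , eq = t , H , trans (sym (++-identityʳ _)) eq

-- Layered permutations

-- Together with `Avoids213`, this is avoidance of 231 and 312 by π, read on the reversed word.
Avoids132 : List ℕ → Set
Avoids132 ρ = ∀ {x y z} → (x ∷ y ∷ z ∷ []) ⊆ ρ → x < z → z < y → ⊥

up : ℕ → ℕ → List ℕ
up o zero    = []
up o (suc d) = suc o ∷ up (suc o) d

-- The reverse of a layered permutation; d stands for a layer of size d + 1, so that
-- no layer is empty.
layered : List ℕ → List ℕ
layered []       = []
layered (d ∷ ds) = up (length (layered ds)) (suc d) ++ layered ds

up-++ : ∀ o a b → up o (a + b) ≡ up o a ++ up (a + o) b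
up-++ o zero    b = refl
up-++ o (suc a) b = cong (suc o ∷_) (trans (up-++ (suc o) a b) (cong (λ k → up (suc o) a ++ up k b) (+-suc a o)))

length-up : ∀ o d → length (up o d) ≡ d
length-up o zero    = refl
length-up o (suc d) = cong suc (length-up (suc o) d)

up-> : ∀ o d → All (o <_) (up o d)
up-> o zero    = []
up-> o (suc d) = ≤-refl ∷ All.map <⇒≤ (up-> (suc o) d)

up-≤ : ∀ o d → All (_≤ o + d) (up o d)
up-≤ o zero    = []
up-≤ o (suc d) rewrite +-suc o d = s≤s (m≤m+n o d) ∷ up-≤ (suc o) d

applyUpTo-cong : ∀ {A : Set} {f g : ℕ → A} n → (∀ {i} → i < n → f i ≡ g i) → applyUpTo f n ≡ applyUpTo g n
applyUpTo-cong zero    eq = refl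
applyUpTo-cong (suc n) eq = cong₂ _∷_ (eq (s≤s z≤n)) (applyUpTo-cong n (λ i<n → eq (s≤s i<n)))

oneTo-up : ∀ n → oneTo n ≡ up 0 n
oneTo-up n = trans (map-upTo suc n) (go 0 n)
  where
  go : ∀ o n → applyUpTo (λ i → suc (o + i)) n ≡ up o n
  go o zero    = refl
  go o (suc n) = cong₂ _∷_ (cong suc (+-identityʳ o))
    (trans (applyUpTo-cong n (λ {i} _ → cong suc (+-suc o i))) (go (suc o) n))

length-layered : ∀ d ds → length (layered (d ∷ ds)) ≡ suc d + length (layered ds)
length-layered d ds = trans (length-++ (up _ (suc d))) (cong (_+ length (layered ds)) (length-up _ (suc d)))

layered-↭ : ∀ ds → layered ds ↭ up 0 (length (layered ds))
layered-↭ []       = ↭-refl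
layered-↭ (d ∷ ds) = ↭-trans (Perm.++⁺ˡ (up o (suc d)) (layered-↭ ds))
  (↭-trans (++-comm (up o (suc d)) (up 0 o)) (↭-reflexive eq))
  where
  o = length (layered ds)
  eq : up 0 o ++ up o (suc d) ≡ up 0 (length (layered (d ∷ ds)))
  eq = trans (cong (λ k → up 0 o ++ up k (suc d)) (sym (+-identityʳ o)))
    (trans (sym (up-++ 0 o (suc d))) (cong (up 0) (trans (+-comm o (suc d)) (sym (length-layered d ds)))))

layered-≤ : ∀ ds → All (_≤ length (layered ds)) (layered ds)
layered-≤ ds = All-resp-↭ (↭-sym (layered-↭ ds)) (up-≤ 0 _)

pair-⊆ : ∀ {R : ℕ → ℕ → Set} {xs y z} → AllPairs R xs → (y ∷ z ∷ []) ⊆ xs → R y z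
pair-⊆ (_ ∷ ps) (skip _ σ)  = pair-⊆ ps σ
pair-⊆ (p ∷ _)  (refl ∷ σ) = All.lookup p (to∈ σ)

module _ {o ys} (ys≤o : All (_≤ o) ys) (av132 : Avoids132 ys) (av213 : Avoids213 ys) where
  private
    -- For two entries in order, either the later one lies in `ys`, so is at most `o`, or both lie
    -- in the increasing run above `q`. Neither case allows the last two entries of a 132 or 213
    -- that starts in the run.
    pairs : ∀ {p q} d → q ≤ p → AllPairs (λ y z → z ≤ o ⊎ (q < y × y < z)) (up p d ++ ys)
    pairs {q = q} zero q≤p = go ys≤o
      where
      go : ∀ {zs} → All (_≤ o) zs → AllPairs (λ y z → z ≤ o ⊎ (q < y × y < z)) zs
      go []       = []
      go (_ ∷ zs) = All.map inj₁ zs ∷ go zs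
    pairs {p} (suc d) q≤p =
      All.++⁺ (All.map (λ r → inj₂ (s≤s q≤p , r)) (up-> (suc p) d)) (All.map inj₁ ys≤o)
      ∷ pairs d (m≤n⇒m≤1+n q≤p)

  up-avoids132 : ∀ {p} d → o ≤ p → Avoids132 (up p d ++ ys)
  up-avoids132 zero    _   σ = av132 σ
  up-avoids132 (suc d) o≤p (skip _ σ) = up-avoids132 d (m≤n⇒m≤1+n o≤p) σ
  up-avoids132 (suc d) o≤p (refl ∷ σ) x<z z<y with pair-⊆ (pairs d ≤-refl) σ
  ... | inj₁ z≤o       = <⇒≱ x<z (≤-trans z≤o (m≤n⇒m≤1+n o≤p))
  ... | inj₂ (_ , y<z) = <-asym y<z z<y

  up-avoids213 : ∀ {p} d → o ≤ p → Avoids213 (up p d ++ ys)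
  up-avoids213 zero    _   σ = av213 σ
  up-avoids213 (suc d) o≤p (skip _ σ) = up-avoids213 d (m≤n⇒m≤1+n o≤p) σ
  up-avoids213 (suc d) o≤p (refl ∷ σ) y<x x<z with pair-⊆ (pairs d ≤-refl) σ
  ... | inj₁ z≤o       = <⇒≱ x<z (≤-trans z≤o (m≤n⇒m≤1+n o≤p))
  ... | inj₂ (x<y , _) = <-asym x<y y<x

layered-avoids : ∀ ds → Avoids132 (layered ds) × Avoids213 (layered ds)
layered-avoids []       = (λ ()) , (λ ())
layered-avoids (d ∷ ds) with layered-avoids ds
... | av132 , av213 = up-avoids132 (layered-≤ ds) av132 av213 (suc d) ≤-refl
                    , up-avoids213 (layered-≤ ds) av132 av213 (suc d) ≤-refl

-- Entries above x come first and in increasing order: 213 forbids a smaller entry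
-- before them, 132 a larger one before a smaller one.
peel : ∀ {x w p R} c → x ≤ p → All (_< x) R → Avoids132 (x ∷ w) → Avoids213 (x ∷ w) →
  w ↭ up p c ++ R → ∃ λ w′ → w ≡ up p c ++ w′ × w′ ↭ R
peel {w = w} zero _ _ _ _ w↭ = w , refl , w↭
peel {w = []} (suc c) _ _ _ _ w↭ with ∈-resp-↭ (↭-sym w↭) (here refl)
... | ()
peel {x} {y ∷ w} {p} {R} (suc c) x≤p R<x av132 av213 w↭ = go first
  where
  first : y ≡ suc p
  first with ∈-resp-↭ (↭-sym w↭) (here refl) | ∈-++⁻ (up p (suc c)) (∈-resp-↭ w↭ (here refl))
  ... | here p≡y | _                = sym p≡y
  ... | there _  | inj₁ (here y≡p)  = y≡p
  ... | there p∈ | inj₁ (there y∈) = ⊥-elim (av132 (refl ∷ refl ∷ from∈ p∈) (s≤s x≤p) (All.lookup (up-> (suc p) c) y∈))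
  ... | there p∈ | inj₂ y∈R        = ⊥-elim (av213 (refl ∷ refl ∷ from∈ p∈) (All.lookup R<x y∈R) (s≤s x≤p))
  go : y ≡ suc p → ∃ λ w′ → y ∷ w ≡ up p (suc c) ++ w′ × w′ ↭ R
  go refl with peel c ≤-refl (All.map (λ r<x → ≤-trans r<x (m≤n⇒m≤1+n x≤p)) R<x)
                 (λ σ → av132 (skip x σ)) (λ σ → av213 (skip x σ)) (drop-∷ w↭)
  ... | w′ , eq , w′↭ = w′ , cong (y ∷_) eq , w′↭

-- If the first entry is `suc o`, `peel` shows that the larger entries follow it at once in
-- increasing order. This is the first layer; what remains is an arrangement of 1 to `o`, and `go`
-- recurses on a bound for the size.
avoids-layered : ∀ {n w} → w ↭ up 0 n → Avoids132 w → Avoids213 w → ∃ λ ds → w ≡ layered ds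
avoids-layered {n} = go n ≤-refl
  where
  go : ∀ b {n w} → n ≤ b → w ↭ up 0 n → Avoids132 w → Avoids213 w → ∃ λ ds → w ≡ layered ds
  go b {w = []} _ _ _ _ = [] , refl
  go zero {zero} {x ∷ w} _ w↭ _ _ with ∈-resp-↭ w↭ (here refl)
  ... | ()
  go (suc b) {n} {x ∷ w} n≤b w↭ av132 av213
    with All.lookup (up-> 0 n) (∈-resp-↭ w↭ (here refl)) | All.lookup (up-≤ 0 n) (∈-resp-↭ w↭ (here refl))
  ... | s≤s {n = o} z≤n | o<n with m≤n⇒∃[o]m+o≡n o<n
  ...   | c , refl with peel c ≤-refl (All.map s≤s (up-≤ 0 o)) av132 av213 w↭′
    where
    w↭′ : w ↭ up (suc o) c ++ up 0 o
    w↭′ = ↭-trans (drop-mid [] (up 0 o) (↭-trans w↭ (↭-reflexive eq))) (++-comm (up 0 o) (up (suc o) c))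
      where
      eq : up 0 (suc o + c) ≡ up 0 o ++ suc o ∷ up (suc o) c
      eq = trans (cong (up 0) (sym (+-suc o c)))
                 (trans (up-++ 0 o (suc c)) (cong (λ k → up 0 o ++ up k (suc c)) (+-identityʳ o)))
  ...     | w′ , refl , w′↭ with go b (≤-trans (m≤m+n o c) (s≤s⁻¹ n≤b)) w′↭
                                  (λ σ → av132 (skip _ (⊆-++ˡ σ))) (λ σ → av213 (skip _ (⊆-++ˡ σ)))
    where
    ⊆-++ˡ : ∀ {σ} → σ ⊆ w′ → σ ⊆ up (suc o) c ++ w′
    ⊆-++ˡ = Sublist.++⁺ˡ (up (suc o) c)
  ...       | ds , refl = c ∷ ds , cong (λ k → up k (suc c) ++ layered ds) o≡
    where
    o≡ : o ≡ length (layered ds)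
    o≡ = sym (trans (↭-length w′↭) (length-up 0 o))

-- Layer sizes and step words

layersFrom : List Step → ℕ × List ℕ
layersFrom []      = 0 , []
layersFrom (D ∷ w) = suc (proj₁ (layersFrom w)) , proj₂ (layersFrom w)
layersFrom (U ∷ w) = 0 , proj₁ (layersFrom w) ∷ proj₂ (layersFrom w)

layers : List Step → List ℕ
layers w = proj₁ (layersFrom w) ∷ proj₂ (layersFrom w)

-- A layer of size d + 1 contributes d steps `D`, and each passage to the next layer is a `U`.
word : ℕ → List ℕ → List Step
word zero    []       = []
word zero    (d ∷ ds) = U ∷ word d ds
word (suc d) ds       = D ∷ word d ds

word-layers : ∀ w → word (proj₁ (layersFrom w)) (proj₂ (layersFrom w)) ≡ w
word-layers []      = refl
word-layers (D ∷ w) = cong (D ∷_) (word-layers w)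
word-layers (U ∷ w) = cong (U ∷_) (word-layers w)

layers-word : ∀ d ds → layersFrom (word d ds) ≡ (d , ds)
layers-word zero    []       = refl
layers-word zero    (d ∷ ds) rewrite layers-word d ds = refl
layers-word (suc d) ds       rewrite layers-word d ds = refl

-- In `go` the offset is any `o` at least the length of the rest, because removing the first entry
-- of a layer raises the offset.
profile-layered : ∀ d ds → profile (layered (d ∷ ds)) ≡ word d ds
profile-layered d ds = go d ds ≤-refl
  where
  go : ∀ {o} d ds → length (layered ds) ≤ o → profile (up o (suc d) ++ layered ds) ≡ word d ds
  go zero [] _ = refl
  go zero (e ∷ ds) le = cong₂ _∷_
    (step-U (s≤s (≤-trans (≤-trans (s≤s (m≤n+m _ e)) (≤-reflexive (sym (length-layered e ds)))) le)))
    (go e ds ≤-refl)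
  go {o} (suc d) ds le = cong₂ _∷_ (step-D (n≤1+n (suc o))) (go d ds (m≤n⇒m≤1+n le))

profile-layers : ∀ w → profile (layered (layers w)) ≡ w
profile-layers w = trans (profile-layered (proj₁ (layersFrom w)) (proj₂ (layersFrom w))) (word-layers w)

length-layered-word : ∀ d ds → length (layered (d ∷ ds)) ≡ suc (length (word d ds))
length-layered-word d ds = cong suc (trans (sym (length-profile (suc o) (up (suc o) d ++ layered ds)))
  (cong length (profile-layered d ds)))
  where
  o = length (layered ds)

-- Inverses and descents

down : ℕ → ℕ → List ℕ
down o zero    = []
down o (suc d) = suc (o + d) ∷ down o d

reverse-up : ∀ o d → reverse (up o d) ≡ down o d
reverse-up o zero    = refl
reverse-up o (suc d) = trans (unfold-reverse (suc o) (up (suc o) d))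
  (trans (cong (_∷ʳ suc o) (reverse-up (suc o) d)) (snoc d))
  where
  snoc : ∀ d → down (suc o) d ∷ʳ suc o ≡ down o (suc d)
  snoc zero    = cong (λ k → suc k ∷ []) (sym (+-identityʳ o))
  snoc (suc d) = cong₂ _∷_ (cong suc (sym (+-suc o d))) (snoc d)

indexOf-∈ : ∀ {j xs ys} → j ∈ xs → indexOf j (xs ++ ys) ≡ indexOf j xs
indexOf-∈ {j} {x ∷ xs} j∈ with x ≡ᵇ j in eq | j∈
... | true  | _         = refl
... | false | there j∈′ = cong suc (indexOf-∈ j∈′)
... | false | here refl with trans (sym eq) (≡ᵇ-refl j)
...   | ()

indexOf-∉ : ∀ {j} xs {ys} → j ∉ xs → indexOf j (xs ++ ys) ≡ length xs + indexOf j ys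
indexOf-∉ [] _ = refl
indexOf-∉ {j} (x ∷ xs) j∉ rewrite ≢⇒≡ᵇ-false {x} {j} (λ e → j∉ (here (sym e))) =
  cong suc (indexOf-∉ xs (λ j∈ → j∉ (there j∈)))

indexOf-down : ∀ o i k → indexOf (suc (o + i)) (down o (suc (i + k))) ≡ k
indexOf-down o i zero    rewrite +-identityʳ i | ≡ᵇ-refl (o + i) = refl
indexOf-down o i (suc k)
  rewrite ≢⇒≡ᵇ-false {o + (i + suc k)} {o + i} (λ e → m+1+n≢m i (+-cancelˡ-≡ o _ _ e)) | +-suc i k =
  cong suc (indexOf-down o i k)

-- The searched list `down o (i + k)` stays fixed throughout the induction, while `i` counts the
-- entries already treated.
down-involution : ∀ o i k → map (λ j → suc (o + indexOf j (down o (i + k)))) (up (o + i) k) ≡ down o k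
down-involution o i zero    = refl
down-involution o i (suc k) = cong₂ _∷_ head tail
  where
  head : suc (o + indexOf (suc (o + i)) (down o (i + suc k))) ≡ suc (o + k)
  head rewrite +-suc i k = cong (λ z → suc (o + z)) (indexOf-down o i k)
  tail : map (λ j → suc (o + indexOf j (down o (i + suc k)))) (up (suc (o + i)) k) ≡ down o k
  tail rewrite +-suc i k | sym (+-suc o i) = down-involution o (suc i) k

-- A layered permutation is a direct sum of decreasing blocks, each its own inverse. The values up
-- to `o` are found in `P`, the larger ones in the block after it.
inv-layered : ∀ ds → inv (reverse (layered ds)) ≡ reverse (layered ds)
inv-layered ds = trans (cong (map _) (trans (oneTo-up _) (cong (up 0) (length-reverse (layered ds))))) (go ds)
  where
  go : ∀ ds → map (λ j → suc (indexOf j (reverse (layered ds)))) (up 0 (length (layered ds))) ≡ reverse (layered ds)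
  go []       = refl
  go (d ∷ ds) = begin
    map (λ j → suc (indexOf j (reverse (layered (d ∷ ds))))) (up 0 (length (layered (d ∷ ds))))
      ≡⟨ cong₂ (λ u v → map (λ j → suc (indexOf j u)) v) rev range ⟩
    map f (up 0 o ++ up o (suc d))
      ≡⟨ map-++ f (up 0 o) (up o (suc d)) ⟩
    map f (up 0 o) ++ map f (up o (suc d))
      ≡⟨ cong₂ _++_ (map-cong-local (All.tabulate λ j∈ → cong suc (indexOf-∈ (low j∈))))
                    (map-cong-local (All.tabulate λ {j} j∈ → cong suc 
                      (trans (indexOf-∉ P (high j∈)) (cong (_+ indexOf j (down o (suc d))) lenP)))) ⟩
    map (λ j → suc (indexOf j P)) (up 0 o) ++ map g (up o (suc d))
      ≡⟨ cong₂ _++_ (go ds)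
           (trans (cong (λ k → map g (up k (suc d))) (sym (+-identityʳ o))) (down-involution o 0 (suc d))) ⟩
    P ++ down o (suc d)
      ≡⟨ rev ⟨
    reverse (layered (d ∷ ds)) ∎
    where
    open ≡-Reasoning
    o = length (layered ds)
    P = reverse (layered ds)
    f g : ℕ → ℕ
    g j = suc (o + indexOf j (down o (suc d)))
    f j = suc (indexOf j (P ++ down o (suc d)))
    lenP : length P ≡ o
    lenP = length-reverse (layered ds)
    rev : reverse (layered (d ∷ ds)) ≡ P ++ down o (suc d)
    rev = trans (reverse-++ (up o (suc d)) (layered ds)) (cong (P ++_) (reverse-up o (suc d)))
    range : up 0 (length (layered (d ∷ ds))) ≡ up 0 o ++ up o (suc d)
    range = trans (cong (up 0) (trans (length-layered d ds) (+-comm (suc d) o)))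
                  (trans (up-++ 0 o (suc d)) (cong (λ k → up 0 o ++ up k (suc d)) (+-identityʳ o)))
    P↭ : P ↭ up 0 o
    P↭ = ↭-trans (↭-reverse (layered ds)) (layered-↭ ds)
    low : ∀ {j} → j ∈ up 0 o → j ∈ P
    low = ∈-resp-↭ (↭-sym P↭)
    high : ∀ {j} → j ∈ up o (suc d) → j ∉ P
    high j∈ j∈P = <⇒≱ (All.lookup (up-> o (suc d)) j∈) (All.lookup (up-≤ 0 o) (∈-resp-↭ P↭ j∈P))

-- The two components of `DL` as profiles

profile-at : ∀ x xs → profile (x ∷ xs) ≡ applyUpTo (λ j → step (at (x ∷ xs) j) (at (x ∷ xs) (suc j))) (length xs)
profile-at x []       = refl
profile-at x (y ∷ ys) = cong (step x y ∷_) (profile-at y ys)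

at-++ˡ : ∀ xs {ys i} → i < length xs → at (xs ++ ys) i ≡ at xs i
at-++ˡ (x ∷ xs) {i = zero}  _        = refl
at-++ˡ (x ∷ xs) {i = suc i} (s≤s lt) = at-++ˡ xs lt

at-length : ∀ xs {y ys} → at (xs ++ y ∷ ys) (length xs) ≡ y
at-length []       = refl
at-length (x ∷ xs) = at-length xs

at-reverse : ∀ xs {i} → i < length xs → at (reverse xs) (length xs ∸ suc i) ≡ at xs i
at-reverse (x ∷ xs) {zero} _ = trans (cong₂ at (unfold-reverse x xs) (sym (length-reverse xs))) (at-length (reverse xs))
at-reverse (x ∷ xs) {suc i} (s≤s lt) = trans (cong (λ w → at w (length xs ∸ suc i)) (unfold-reverse x xs))
  (trans (at-++ˡ (reverse xs) (subst (length xs ∸ suc i <_) (sym (length-reverse xs)) (∸-monoʳ-< (s≤s z≤n) lt)))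
         (at-reverse xs lt))

unique-adjacent : ∀ {ρ j} → Unique ρ → suc j < length ρ → at ρ j ≢ at ρ (suc j)
unique-adjacent {x ∷ []} {zero} _ (s≤s ())
unique-adjacent {x ∷ y ∷ ys} {zero}  ((x≢y ∷ _) ∷ _) _ = x≢y
unique-adjacent {x ∷ y ∷ ys} {suc j} (_ ∷ u) (s≤s lt)  = unique-adjacent u lt

-- Λ tests for a rise of `ρ` and `step` for a drop; these tests are complementary only on distinct
-- entries.
step-swap : ∀ {x y} → x ≢ y → (if x <ᵇ y then D else U) ≡ step x y
step-swap {x} {y} x≢y with <-cmp x y
... | tri< x<y _ _ rewrite <ᵇ-true x<y | <ᵇ-false (<⇒≤ x<y) = refl
... | tri≈ _ x≡y _ = ⊥-elim (x≢y x≡y)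
... | tri> _ _ y<x rewrite <ᵇ-true y<x | <ᵇ-false (<⇒≤ y<x) = refl

map-oneTo : ∀ {A : Set} (f : ℕ → A) n → map f (oneTo n) ≡ applyUpTo (f ∘ suc) n
map-oneTo f n = trans (cong (map f) (map-upTo suc n)) (map-applyUpTo suc f n)

descents-profile : ∀ x xs → map (λ i → if isDes (x ∷ xs) i then U else D) (oneTo (length xs)) ≡ profile (x ∷ xs)
descents-profile x xs = trans (map-oneTo _ (length xs))
  (trans (applyUpTo-cong (length xs) pointwise) (sym (profile-at x xs)))
  where
  ρ = x ∷ xs
  pointwise : ∀ {j} → j < length xs → (if isDes ρ (suc j) then U else D) ≡ step (at ρ j) (at ρ (suc j))
  pointwise j< rewrite <ᵇ-true j< = refl

ascents-profile : ∀ x xs → Unique (x ∷ xs) →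
  map (λ i → if isDes (reverse (x ∷ xs)) (suc (length xs) ∸ i) then D else U) (oneTo (length xs)) ≡ profile (x ∷ xs)
ascents-profile x xs u = trans (map-oneTo _ (length xs))
  (trans (applyUpTo-cong (length xs) pointwise) (sym (profile-at x xs)))
  where
  ρ = x ∷ xs
  π = reverse ρ
  pointwise : ∀ {j} → j < length xs → (if isDes π (length xs ∸ j) then D else U) ≡ step (at ρ j) (at ρ (suc j))
  pointwise {j} j<
    -- Since `j < length xs`, this index is a successor and `isDes` unfolds; the two entries of `π`
    -- it compares are those of `ρ` at `j` and `suc j`.
    with length xs ∸ j | +-∸-assoc 1 j< | at-reverse ρ (m≤n⇒m≤1+n j<) | m∸n≤m (length xs) j
  ... | _ | refl | at-j | le
    rewrite length-reverse ρ | <ᵇ-true le | at-j | at-reverse ρ (s≤s j<) = step-swap (unique-adjacent u (s≤s j<))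

-- For an involution `rot` is plain reversal, so Λ' records the descents of `ρ`, which are the
-- ascents recorded by Λ.
DL-profile : ∀ k ρ → length ρ ≡ suc (2 * k) → Unique ρ → inv (reverse ρ) ≡ reverse ρ →
  DL k (reverse ρ) ≡ (profile ρ , profile ρ)
DL-profile k ρ@(x ∷ xs) len u inv≡ = cong₂ _,_
  (subst (λ m → map (λ i → if isDes (reverse ρ) (suc m ∸ i) then D else U) (oneTo m) ≡ profile ρ)
         length-xs (ascents-profile x xs u))
  (trans (cong₂ (λ σ m → map (λ i → if isDes σ i then U else D) (oneTo m)) rot≡ (sym length-xs)) (descents-profile x xs))
  where
  length-xs : length xs ≡ 2 * k
  length-xs = suc-injective len
  rot≡ : rot (reverse ρ) ≡ ρ
  rot≡ = trans (cong reverse inv≡) (reverse-involutive ρ)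

-- Pattern avoidance under reversal

private
  both : ∀ {A B : Set} → A → B → A ⇔ B
  both a b = mk⇔ (λ _ → b) (λ _ → a)

  neither : ∀ {A B : Set} → ¬ A → ¬ B → A ⇔ B
  neither ¬a ¬b = mk⇔ (λ a → ⊥-elim (¬a a)) (λ b → ⊥-elim (¬b b))

  triple : ∀ {a b c p q r} → (a < b ⇔ p < q) → (b < a ⇔ q < p) → (a < c ⇔ p < r) → (c < a ⇔ r < p) →
    (b < c ⇔ q < r) → (c < b ⇔ r < q) → SameOrder (a ∷ b ∷ c ∷ []) (p ∷ q ∷ r ∷ [])
  triple {a} {b} {c} {p} {q} {r} ab ba ac ca bc cb = refl , λ where
    0 0 _ _ → neither (<-irrefl refl) (<-irrefl refl)
    0 1 _ _ → ab
    0 2 _ _ → ac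
    1 0 _ _ → ba
    1 1 _ _ → neither (<-irrefl refl) (<-irrefl refl)
    1 2 _ _ → bc
    2 0 _ _ → ca
    2 1 _ _ → cb
    2 2 _ _ → neither (<-irrefl refl) (<-irrefl refl)
    (suc (suc (suc i))) _ (s≤s (s≤s (s≤s ()))) _
    0 (suc (suc (suc i))) _ (s≤s (s≤s (s≤s ())))
    1 (suc (suc (suc i))) _ (s≤s (s≤s (s≤s ())))
    2 (suc (suc (suc i))) _ (s≤s (s≤s (s≤s ())))

avoids231⇒ : ∀ {ρ} → Avoids (reverse ρ) (2 ∷ 3 ∷ 1 ∷ []) → Avoids132 ρ
avoids231⇒ av {x} {y} {z} σ x<z z<y = av (z ∷ y ∷ x ∷ [] , Sublist.reverse⁺ σ , triple
  (both z<y (s≤s (s≤s (s≤s z≤n))))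
  (neither (<-asym z<y) λ { (s≤s (s≤s ())) })
  (neither (<-asym x<z) λ { (s≤s ()) })
  (both x<z (s≤s (s≤s z≤n)))
  (neither (<-asym (<-trans x<z z<y)) λ { (s≤s ()) })
  (both (<-trans x<z z<y) (s≤s (s≤s z≤n))))

avoids312⇒ : ∀ {ρ} → Avoids (reverse ρ) (3 ∷ 1 ∷ 2 ∷ []) → Avoids213 ρ
avoids312⇒ av {x} {y} {z} σ y<x x<z = av (z ∷ y ∷ x ∷ [] , Sublist.reverse⁺ σ , triple
  (neither (<-asym (<-trans y<x x<z)) λ { (s≤s ()) })
  (both (<-trans y<x x<z) (s≤s (s≤s z≤n)))
  (neither (<-asym x<z) λ { (s≤s (s≤s ())) })
  (both x<z (s≤s (s≤s (s≤s z≤n))))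
  (both y<x (s≤s (s≤s z≤n)))
  (neither (<-asym y<x) λ { (s≤s ()) }))

⊆-unreverse : ∀ {σ ρ : List ℕ} → σ ⊆ reverse ρ → reverse σ ⊆ ρ
⊆-unreverse {σ} {ρ} σ⊆ = subst (reverse σ ⊆_) (reverse-involutive ρ) (Sublist.reverse⁺ σ⊆)

avoids231⇐ : ∀ {ρ} → Avoids132 ρ → Avoids (reverse ρ) (2 ∷ 3 ∷ 1 ∷ [])
avoids231⇐ av (a ∷ b ∷ c ∷ [] , σ⊆ , _ , same) = av (⊆-unreverse σ⊆)
  -- The comparisons third below first and first below second of 231 are exactly the two that define
  -- 132 in the reversed word.
  (Equivalence.from (same 2 0 (s≤s (s≤s (s≤s z≤n))) (s≤s z≤n)) (s≤s (s≤s z≤n)))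
  (Equivalence.from (same 0 1 (s≤s z≤n) (s≤s (s≤s z≤n))) (s≤s (s≤s (s≤s z≤n))))

avoids312⇐ : ∀ {ρ} → Avoids213 ρ → Avoids (reverse ρ) (3 ∷ 1 ∷ 2 ∷ [])
avoids312⇐ av (a ∷ b ∷ c ∷ [] , σ⊆ , _ , same) = av (⊆-unreverse σ⊆)
  (Equivalence.from (same 1 2 (s≤s (s≤s z≤n)) (s≤s (s≤s (s≤s z≤n)))) (s≤s (s≤s z≤n)))
  (Equivalence.from (same 2 0 (s≤s (s≤s (s≤s z≤n))) (s≤s z≤n)) (s≤s (s≤s (s≤s z≤n))))

-- Uniquely sorted permutations and walks

isPerm-unique : ∀ {n w} → IsPerm n w → Unique w
isPerm-unique {n} w↭ = PermSetoid.Unique-resp-↭ (setoid ℕ) (↭⇒↭ₛ (↭-sym w↭)) (Unique.map⁺ suc-injective (Unique.upTo⁺ n))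

isPerm-length : ∀ {n w} → IsPerm n w → length w ≡ n
isPerm-length {n} w↭ = trans (↭-length w↭) (trans (cong length (oneTo-up n)) (length-up 0 n))

nonempty : ∀ {t ρ} → ρ ≢ [] → rpost t ≡ ρ → t ≢ nil
nonempty ρ≢ refl refl = ρ≢ refl

isPerm-reverse-nonempty : ∀ {m π} → IsPerm (suc m) π → reverse π ≢ []
isPerm-reverse-nonempty {m} {π} π↭ eq with trans (sym (isPerm-length π↭)) (trans (sym (length-reverse π)) (cong length eq))
... | ()

s-preimage : ∀ {σ} → Unique σ → ∃ λ t → Heap t × inorder t ≡ σ × rpost t ≡ reverse (s σ)
s-preimage u with heap-of _ u
... | t , H , refl = t , H , refl , trans (sym (reverse-involutive (rpost t)))
                       (cong reverse (trans (rpost-postorder t) (sym (s-inorder H))))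

s-heap : ∀ {t ρ} → Heap t → rpost t ≡ ρ → s (inorder t) ≡ reverse ρ
s-heap {t} H refl = trans (s-inorder H) (sym (rpost-postorder t))

-- The preimage is the inorder word of a tree. Another heap with the same postorder word would yield
-- a second preimage, so the tree is good and its profile is a walk.
uniquelySorted-walk : ∀ {m π} → IsPerm (suc m) π → UniquelySorted (suc m) π → Walk 0 (profile (reverse π))
uniquelySorted-walk {m} {π} π↭ (σ , σ↭ , refl , uniq) with s-preimage (isPerm-unique σ↭)
... | t , H , refl , et =
  subst (Walk 0) (trans (++-identityʳ _) (cong profile et))
    (good-walk H (only-good H only (nonempty (isPerm-reverse-nonempty π↭) et)) [])
  where
  only : OnlyHeap t
  only {t′} H′ eq = inorder-injective H′ H (uniq (inorder t′)
    (↭-trans (inorder↭rpost t′) (↭-trans (↭-reflexive eq) (↭-trans (↭-sym (inorder↭rpost t)) σ↭)))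
    (trans (s-heap H′ (trans eq et)) (reverse-involutive (s (inorder t)))))

-- Existence is the stack construction. For uniqueness, the tree of any preimage has the same
-- balanced profile, so it is good by `tight`, and good trees are determined by their words.
walk-uniquelySorted : ∀ {m π} → IsPerm (suc m) π → Avoids213 (reverse π) → Walk 0 (profile (reverse π)) →
  UniquelySorted (suc m) π
walk-uniquelySorted {m} {π} π↭ av w
  with heap-exists (isPerm-reverse-nonempty π↭) (isPerm-unique (↭-trans (↭-reverse π) π↭)) av w
... | t , H , et = inorder t
    , ↭-trans (inorder↭rpost t) (↭-trans (↭-reflexive et) (↭-trans (↭-reverse π) π↭))
    , trans (s-heap H et) (reverse-involutive π)
    , uniq
  where
  good : ∀ {t} → Heap t → rpost t ≡ reverse π → Good t
  good H eq = proj₂ (tight H) (nonempty (isPerm-reverse-nonempty π↭) eq) (subst (Balanced ∘ profile) (sym eq) (walk-count w))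
  uniq : ∀ τ → IsPerm (suc m) τ → s τ ≡ π → τ ≡ inorder t
  uniq τ τ↭ refl with s-preimage (isPerm-unique τ↭)
  ... | t′ , H′ , refl , et′ = cong inorder (good-injective H′ H (good H′ et′) (good H et) (trans et′ (sym et)))

-- Dyck paths as walks

walk-prefix : ∀ {h w} → Walk h w → ∀ i → countD (take i w) ≤ h + countU (take i w)
walk-prefix _ zero = z≤n
walk-prefix [] (suc i) = z≤n
walk-prefix {h} (U∷ p) (suc i) = ≤-trans (walk-prefix p i) (≤-reflexive (sym (+-suc h _)))
walk-prefix (D∷ p) (suc i) = s≤s (walk-prefix p i)

prefix-walk : ∀ {h} w → (∀ i → countD (take i w) ≤ h + countU (take i w)) → countD w ≡ h + countU w → Walk h w
prefix-walk {h} [] _ eq rewrite m+n≡0⇒m≡0 h (sym eq) = []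
prefix-walk {h} (U ∷ w) pre eq =
  U∷ prefix-walk w (λ i → ≤-trans (pre (suc i)) (≤-reflexive (+-suc h _))) (trans eq (+-suc h _))
prefix-walk {zero} (D ∷ w) pre eq with pre 1
... | ()
prefix-walk {suc h} (D ∷ w) pre eq = D∷ prefix-walk w (λ i → s≤s⁻¹ (pre (suc i))) (suc-injective eq)

length-count : ∀ w → length w ≡ countU w + countD w
length-count []      = refl
length-count (U ∷ w) = cong suc (length-count w)
length-count (D ∷ w) = trans (cong suc (length-count w)) (sym (+-suc (countU w) _))

dyck-walk : ∀ {k w} → IsDyck k w → Walk 0 w × countU w ≡ k
dyck-walk {w = w} (u , d , pre) = prefix-walk w pre (trans d (sym u)) , u

walk-dyck : ∀ {k w} → Walk 0 w → countU w ≡ k → IsDyck k w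
walk-dyck p u = u , trans (sym (walk-count p)) u , walk-prefix p

walk-length : ∀ {k w} → Walk 0 w → length w ≡ 2 * k → countU w ≡ k
walk-length {k} {w} p len = *-cancelˡ-≡ _ _ 2
  (trans (cong (countU w +_) (trans (+-identityʳ _) (walk-count p))) (trans (sym (length-count w)) len))

-- Counting Dyck paths

-- All words with u letters U and u + h letters D that, starting from height h, never
-- go below 0.
walks : ℕ → ℕ → List (List Step)
walks zero    zero    = [] ∷ []
walks zero    (suc h) = map (D ∷_) (walks zero h)
walks (suc u) zero    = map (U ∷_) (walks u 1)
walks (suc u) (suc h) = map (U ∷_) (walks u (suc (suc h))) ++ map (D ∷_) (walks (suc u) h)

walks-sound : ∀ u h {w} → w ∈ walks u h → Walk h w × countU w ≡ u
walks-sound zero zero (here refl) = [] , refl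
walks-sound zero (suc h) w∈ with ∈-map⁻ (D ∷_) w∈
... | w , w∈′ , refl with walks-sound zero h w∈′
... | p , c = D∷ p , c
walks-sound (suc u) zero w∈ with ∈-map⁻ (U ∷_) w∈
... | w , w∈′ , refl with walks-sound u 1 w∈′
... | p , c = U∷ p , cong suc c
walks-sound (suc u) (suc h) w∈ with ∈-++⁻ (map (U ∷_) (walks u (suc (suc h)))) w∈
... | inj₁ w∈ᵘ with ∈-map⁻ (U ∷_) w∈ᵘ
...   | w , w∈′ , refl with walks-sound u (suc (suc h)) w∈′
...     | p , c = U∷ p , cong suc c
walks-sound (suc u) (suc h) w∈ | inj₂ w∈ᵈ with ∈-map⁻ (D ∷_) w∈ᵈ
...   | w , w∈′ , refl with walks-sound (suc u) h w∈′
...     | p , c = D∷ p , c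

walks-complete : ∀ {h w} → Walk h w → w ∈ walks (countU w) h
walks-complete [] = here refl
walks-complete {zero}  (U∷ p) = ∈-map⁺ (U ∷_) (walks-complete p)
walks-complete {suc h} (U∷ p) = ∈-++⁺ˡ (∈-map⁺ (U ∷_) (walks-complete p))
walks-complete {suc h} (D∷_ {w = w} p) with countU w | walks-complete p
... | zero  | w∈ = ∈-map⁺ (D ∷_) w∈
... | suc u | w∈ = ∈-++⁺ʳ (map (U ∷_) (walks u (suc (suc h)))) (∈-map⁺ (D ∷_) w∈)

walks-unique : ∀ u h → Unique (walks u h)
walks-unique zero    zero    = [] ∷ []
walks-unique zero    (suc h) = Unique.map⁺ ∷-injectiveʳ (walks-unique zero h)
walks-unique (suc u) zero    = Unique.map⁺ ∷-injectiveʳ (walks-unique u 1)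
walks-unique (suc u) (suc h) = Unique.++⁺ (Unique.map⁺ ∷-injectiveʳ (walks-unique u _))
  (Unique.map⁺ ∷-injectiveʳ (walks-unique (suc u) h)) disjoint
  where
  disjoint : ∀ {w} → ¬ (w ∈ map (U ∷_) (walks u (suc (suc h))) × w ∈ map (D ∷_) (walks (suc u) h))
  disjoint (w∈ᵘ , w∈ᵈ) with ∈-map⁻ (U ∷_) w∈ᵘ | ∈-map⁻ (D ∷_) w∈ᵈ
  ... | _ , _ , refl | _ , _ , ()

-- n C (k - 1), with value 0 at k = 0.
infixl 6.5 _C⁻_
_C⁻_ : ℕ → ℕ → ℕ
n C⁻ zero  = 0
n C⁻ suc k = n C k

pascal : ∀ n k → n C⁻ k + n C k ≡ suc n C k
pascal n zero    = refl
pascal n (suc k) = nCk+nC[k+1]≡[n+1]C[k+1] n k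

central : ∀ u → suc (2 * u) C suc u ≡ suc (2 * u) C u
central u = trans (nCk≡nC[n∸k] (s≤s (m≤m+n u _))) (cong (suc (2 * u) C_) (trans (m+n∸m≡n u (u + 0)) (+-identityʳ u)))

-- The formula is that of the reflection principle.
ballot : ∀ u h → length (walks u h) + (2 * u + h) C⁻ u ≡ (2 * u + h) C u
ballot zero zero    = refl
ballot zero (suc h) = trans (cong (_+ 0) (length-map (D ∷_) (walks zero h))) (ballot zero h)
ballot (suc u) zero = begin
  length (map (U ∷_) (walks u 1)) + (2 * suc u + 0) C u
    ≡⟨ cong₂ (λ a b → a + b C u) (length-map (U ∷_) (walks u 1)) e ⟩
  length (walks u 1) + suc (suc (2 * u)) C u
    ≡⟨ cong (length (walks u 1) +_) (pascal (suc (2 * u)) u) ⟨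
  length (walks u 1) + (suc (2 * u) C⁻ u + suc (2 * u) C u)
    ≡⟨ +-assoc (length (walks u 1)) _ _ ⟨
  length (walks u 1) + suc (2 * u) C⁻ u + suc (2 * u) C u
    ≡⟨ cong (_+ suc (2 * u) C u) (subst (λ N → length (walks u 1) + N C⁻ u ≡ N C u) (+-comm (2 * u) 1) (ballot u 1)) ⟩
  suc (2 * u) C u + suc (2 * u) C u
    -- The symmetry of row 2u + 1 turns the second summand into the term that Pascal's rule
    -- requires.
    ≡⟨ cong (suc (2 * u) C u +_) (central u) ⟨
  suc (2 * u) C u + suc (2 * u) C suc u
    ≡⟨ pascal (suc (2 * u)) (suc u) ⟩
  suc (suc (2 * u)) C suc u
    ≡⟨ cong (_C suc u) e ⟨
  (2 * suc u + 0) C suc u ∎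
  where
  open ≡-Reasoning
  e : 2 * suc u + 0 ≡ suc (suc (2 * u))
  e = trans (+-identityʳ _) (*-suc 2 u)
ballot (suc u) (suc h) = begin
  length (map (U ∷_) A ++ map (D ∷_) B) + (2 * suc u + suc h) C u
    ≡⟨ cong₂ (λ a b → a + b C u)
         (trans (length-++ (map (U ∷_) A)) (cong₂ _+_ (length-map (U ∷_) A) (length-map (D ∷_) B)))
         (+-suc (2 * suc u) h) ⟩
  length A + length B + suc N C u
    ≡⟨ cong (length A + length B +_) (pascal N u) ⟨
  length A + length B + (N C⁻ u + N C u)
    ≡⟨ rearrange (length A) (length B) (N C⁻ u) (N C u) ⟩
  (length A + N C⁻ u) + (length B + N C u)
    ≡⟨ cong₂ _+_ (subst (λ M → length A + M C⁻ u ≡ M C u) e (ballot u (suc (suc h)))) (ballot (suc u) h) ⟩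
  N C u + N C suc u
    ≡⟨ pascal N (suc u) ⟩
  suc N C suc u
    ≡⟨ cong (_C suc u) (+-suc (2 * suc u) h) ⟨
  (2 * suc u + suc h) C suc u ∎
  where
  open ≡-Reasoning
  A = walks u (suc (suc h))
  B = walks (suc u) h
  N = 2 * suc u + h
  rearrange : ∀ a b c d → a + b + (c + d) ≡ (a + c) + (b + d)
  rearrange = solve-∀
  e : 2 * u + suc (suc h) ≡ 2 * suc u + h
  e = shuffle u h
    where
    shuffle : ∀ u h → 2 * u + suc (suc h) ≡ 2 * suc u + h
    shuffle = solve-∀

-- The identity (j + 1) C(n, j + 1) = (n - j) C(n, j) with the subtraction moved to the left side;
-- induction on `n` by Pascal's rule.
absorption : ∀ n j → suc j * (n C suc j) + j * (n C j) ≡ n * (n C j)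
absorption n zero = trans (+-identityʳ _) (trans (+-identityʳ _) (trans (nC1≡n n) (sym (*-identityʳ n))))
absorption zero (suc j) rewrite k>n⇒nCk≡0 {0} {suc (suc j)} (s≤s z≤n) | k>n⇒nCk≡0 {0} {suc j} (s≤s z≤n) | *-zeroʳ j = refl
absorption (suc n) (suc j) = begin
  suc (suc j) * (suc n C suc (suc j)) + suc j * (suc n C suc j)
    ≡⟨ cong₂ (λ a b → suc (suc j) * a + suc j * b) (pascal n (suc (suc j))) (pascal n (suc j)) ⟨
  suc (suc j) * (y + z) + suc j * (x + y)
    ≡⟨ regroup j x y z ⟩
  (suc (suc j) * z + suc j * y) + (suc j * y + j * x) + (x + y)
    ≡⟨ cong₂ (λ a b → a + b + (x + y)) (absorption n (suc j)) (absorption n j) ⟩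
  n * y + n * x + (x + y)
    ≡⟨ factor n x y ⟩
  suc n * (x + y)
    ≡⟨ cong (suc n *_) (pascal n (suc j)) ⟩
  suc n * (suc n C suc j) ∎
  where
  open ≡-Reasoning
  x = n C j
  y = n C suc j
  z = n C suc (suc j)
  regroup : ∀ j x y z → suc (suc j) * (y + z) + suc j * (x + y)
          ≡ (suc (suc j) * z + suc j * y) + (suc j * y + j * x) + (x + y)
  regroup = solve-∀
  factor : ∀ n x y → n * y + n * x + (x + y) ≡ suc n * (x + y)
  factor = solve-∀

-- Multiplying `c + b ≡ a` by k + 1 and replacing (k + 1) b by k a leaves (k + 1) c = a, so the
-- division is exact.
length-walks : ∀ k → length (walks k 0) ≡ ((2 * k) C k) / suc k
length-walks zero = refl
length-walks k@(suc j) = sym (trans (/-congˡ (sym total)) (m*n/n≡m c (suc k)))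
  where
  open ≡-Reasoning
  c = length (walks k 0)
  a = (2 * k) C k
  b = (2 * k) C j
  c+b : c + b ≡ a
  c+b = subst (λ N → c + N C j ≡ N C k) (+-identityʳ (2 * k)) (ballot k 0)
  -- `absorption` for n = 2k; the term `j * b` cancels because 2k = (k + 1) + j.
  ratio : k * a ≡ suc k * b
  ratio = +-cancelʳ-≡ (j * b) _ _ (trans (absorption (2 * k) j) (double j b))
    where
    double : ∀ j b → 2 * suc j * b ≡ suc (suc j) * b + j * b
    double = solve-∀
  total : c * suc k ≡ a
  total = +-cancelʳ-≡ (k * a) _ _ (begin
    c * suc k + k * a     ≡⟨ cong (c * suc k +_) ratio ⟩
    c * suc k + suc k * b ≡⟨ cong (_+ suc k * b) (*-comm c (suc k)) ⟩
    suc k * c + suc k * b ≡⟨ *-distribˡ-+ (suc k) c b ⟨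
    suc k * (c + b)       ≡⟨ cong (suc k *_) c+b ⟩
    a + k * a             ∎)

-- The bijection with Dyck paths

patterns : List (List ℕ)
patterns = (2 ∷ 3 ∷ 1 ∷ []) ∷ (3 ∷ 1 ∷ 2 ∷ []) ∷ []

fromDyck : List Step → List ℕ
fromDyck w = reverse (layered (layers w))

profile-fromDyck : ∀ w → profile (reverse (fromDyck w)) ≡ w
profile-fromDyck w = trans (cong profile (reverse-involutive _)) (profile-layers w)

DL-layered : ∀ k {d ds} → IsPerm (suc (2 * k)) (reverse (layered (d ∷ ds))) →
  DL k (reverse (layered (d ∷ ds))) ≡ (word d ds , word d ds)
DL-layered k {d} {ds} π↭ = trans (DL-profile k ρ (isPerm-length ρ↭) (isPerm-unique ρ↭) (inv-layered (d ∷ ds)))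
    (cong (λ w → w , w) (profile-layered d ds))
  where
  ρ = layered (d ∷ ds)
  ρ↭ : IsPerm (suc (2 * k)) ρ
  ρ↭ = ↭-trans (↭-sym (↭-reverse ρ)) π↭

-- Avoidance makes π layered, hence recoverable from its profile `w`; being uniquely sorted makes
-- `w` a Dyck path.
𝒰-fromDyck : ∀ {k π} → 𝒰 (suc (2 * k)) patterns π → ∃ λ w → IsDyck k w × π ≡ fromDyck w × DL k π ≡ (w , w)
𝒰-fromDyck {k} {π} (π↭ , us , av231 ∷ av312 ∷ []) =
  shape (avoids-layered ρ↭ (avoids231⇒ (unreverse av231)) (avoids312⇒ (unreverse av312)))
  where
  unreverse : ∀ {τ} → Avoids π τ → Avoids (reverse (reverse π)) τ
  unreverse {τ} = subst (λ ρ → Avoids ρ τ) (sym (reverse-involutive π))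
  ρ↭ : reverse π ↭ up 0 (suc (2 * k))
  ρ↭ = ↭-trans (↭-reverse π) (↭-trans π↭ (↭-reflexive (oneTo-up _)))
  walk : Walk 0 (profile (reverse π))
  walk = uniquelySorted-walk π↭ us
  shape : (∃ λ ds → reverse π ≡ layered ds) → ∃ λ w → IsDyck k w × π ≡ fromDyck w × DL k π ≡ (w , w)
  shape ([] , eq) = ⊥-elim (isPerm-reverse-nonempty π↭ eq)
  shape (d ∷ ds , eq) = w , walk-dyck walk′ (walk-length walk′ len) , π≡
    , trans (cong (DL k) π≡ρ) (DL-layered k (subst (IsPerm _) π≡ρ π↭))
    where
    w = word d ds
    π≡ρ : π ≡ reverse (layered (d ∷ ds))
    π≡ρ = trans (sym (reverse-involutive π)) (cong reverse eq)
    π≡ : π ≡ fromDyck w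
    π≡ = trans π≡ρ (cong (λ p → reverse (layered (proj₁ p ∷ proj₂ p))) (sym (layers-word d ds)))
    prof : profile (reverse π) ≡ w
    prof = trans (cong profile eq) (profile-layered d ds)
    walk′ : Walk 0 w
    walk′ = subst (Walk 0) prof walk
    len : length w ≡ 2 * k
    len = suc-injective (trans (sym (length-layered-word d ds))
      (trans (cong length (sym eq)) (trans (length-reverse π) (isPerm-length π↭))))

fromDyck-𝒰 : ∀ {k w} → IsDyck k w → 𝒰 (suc (2 * k)) patterns (fromDyck w) × DL k (fromDyck w) ≡ (w , w)
fromDyck-𝒰 {k} {w} (u , d , pre) =
  (π↭ , walk-uniquelySorted π↭ (subst Avoids213 (sym rev) (proj₂ av))
           (subst (Walk 0) (sym (profile-fromDyck w)) (proj₁ (dyck-walk (u , d , pre))))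
      , avoids231⇐ (proj₁ av) ∷ avoids312⇐ (proj₂ av) ∷ [])
  , trans (DL-layered k π↭) (cong (λ v → v , v) (word-layers w))
  where
  ρ = layered (layers w)
  av = layered-avoids (layers w)
  rev : reverse (fromDyck w) ≡ ρ
  rev = reverse-involutive ρ
  len : length ρ ≡ suc (2 * k)
  len = begin
    length ρ                  ≡⟨ length-layered-word (proj₁ (layersFrom w)) (proj₂ (layersFrom w)) ⟩
    suc (length (word (proj₁ (layersFrom w)) (proj₂ (layersFrom w)))) ≡⟨ cong (suc ∘ length) (word-layers w) ⟩
    suc (length w)            ≡⟨ cong suc (length-count w) ⟩
    suc (countU w + countD w) ≡⟨ cong₂ (λ a b → suc (a + b)) u (trans d (sym (+-identityʳ k))) ⟩
    suc (2 * k)               ∎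
    where open ≡-Reasoning
  π↭ : IsPerm (suc (2 * k)) (fromDyck w)
  π↭ = ↭-trans (↭-reverse ρ) (↭-trans (layered-↭ (layers w)) (↭-reflexive (trans (cong (up 0) len) (sym (oneTo-up _)))))

theorem9p2 : (k : ℕ) →
    let n = suc (2 * k)
        P = (2 ∷ 3 ∷ 1 ∷ []) ∷ (3 ∷ 1 ∷ 2 ∷ []) ∷ []
    in ((π : List ℕ) → 𝒰 n P π → Int𝒜 k (DL k π))
       × ((π π′ : List ℕ) → 𝒰 n P π → 𝒰 n P π′ → DL k π ≡ DL k π′ → π ≡ π′)
       × ((p : List Step × List Step) → Int𝒜 k p → Σ (List ℕ) λ π → 𝒰 n P π × DL k π ≡ p)
       × Σ (List (List ℕ)) λ L → Unique L × ((π : List ℕ) → (π ∈ L) ⇔ 𝒰 n P π)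
           × length L ≡ ((2 * k) C k) / suc k
theorem9p2 k = into , injective , onto , map fromDyck (walks k 0)
  -- `profile ∘ reverse` is a left inverse of `fromDyck`, so distinct walks give distinct
  -- permutations.
  , Unique.map⁺ (λ {v} {w} eq → trans (sym (profile-fromDyck v)) (trans (cong (profile ∘ reverse) eq) (profile-fromDyck w)))
                (walks-unique k 0)
  , (λ π → mk⇔ sound complete)
  , trans (length-map fromDyck (walks k 0)) (length-walks k)
  where
  n = suc (2 * k)
  into : ∀ π → 𝒰 n patterns π → Int𝒜 k (DL k π)
  into π π∈ with 𝒰-fromDyck {k} π∈
  ... | w , dyck , _ , eq = subst (Int𝒜 k) (sym eq) (dyck , dyck , refl)
  injective : ∀ π π′ → 𝒰 n patterns π → 𝒰 n patterns π′ → DL k π ≡ DL k π′ → π ≡ π′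
  injective π π′ π∈ π′∈ eq with 𝒰-fromDyck {k} π∈ | 𝒰-fromDyck {k} π′∈
  ... | w , _ , π≡ , e | w′ , _ , π′≡ , e′ =
    trans π≡ (trans (cong (fromDyck ∘ proj₁) (trans (sym e) (trans eq e′))) (sym π′≡))
  onto : ∀ p → Int𝒜 k p → ∃ λ π → 𝒰 n patterns π × DL k π ≡ p
  onto (w , _) (dyck , _ , refl) = fromDyck w , fromDyck-𝒰 dyck
  sound : ∀ {π} → π ∈ map fromDyck (walks k 0) → 𝒰 n patterns π
  sound π∈ with ∈-map⁻ fromDyck π∈
  ... | w , w∈ , refl with walks-sound k 0 w∈
  ... | p , u = proj₁ (fromDyck-𝒰 (walk-dyck p u))
  complete : ∀ {π} → 𝒰 n patterns π → π ∈ map fromDyck (walks k 0)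
  complete π∈ with 𝒰-fromDyck {k} π∈
  ... | w , dyck , refl , _ with dyck-walk dyck
  ... | p , u = subst (λ j → fromDyck w ∈ map fromDyck (walks j 0)) u (∈-map⁺ fromDyck (walks-complete p))
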